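{- In the worst violated constraint model, there is an algorithm which, given oracle access to a hidden 1SAT instance $\Phi$ on $n$ variables and $m$ clauses (possibly with repeated clauses), determines whether $\Phi$ is satisfiable in time $O(mn^2)$.
   Context: A 1SAT instance on Boolean variables $x_1,\dots,x_n$ is a conjunction of clauses $C_1,\dots,C_m$, each consisting of a single literal ($x_i$ or $\overline{x}_i$). The same literal may occur as several different clauses. Worst violated constraint model: the formula is hidden and is accessed only through an oracle. A query is a probabilistic assignment $\mathbf{a}:[n]\to[0,1]$, meaning that $\Pr[x_i=1]=\mathbf{a}(i)$ and $\Pr[\overline{x}_i=1]=1-\mathbf{a}(i)$. The violation probability of a clause is the probability that its literal is $0$. If all clauses have violation probability $0$, the oracle reports that the formula is satisfied; otherwise it returns the index $j\in[m]$ of a clause with the highest violation probability, breaking ties arbitrarily (possibly adversarially). Running time is total running time, with each oracle query costing unit time. -}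

module Defs where

open import Data.Bool.Base using (Bool; true; false; not; if_then_else_)
open import Data.Fin.Base using (Fin; toℕ)
open import Data.Fin.Properties using (all?)
open import Data.Integer.Base using (+_)
open import Data.List.Base using (List; []; _∷_; _++_)
open import Data.Maybe.Base using (Maybe; just; nothing)
open import Data.Nat.Base using (ℕ; zero; suc; _+_; _∸_; _<ᵇ_)
open import Data.Nat.Properties using (_≟_)
open import Data.Product.Base using (∃-syntax; _×_)
open import Data.Rational.Base using (ℚ; 0ℚ; 1ℚ; _/_; _-_; _≤_)
open import Data.Rational.Properties using (_≤?_)
open import Data.Sum.Base using (_⊎_)
open import Data.Vec.Functional using (Vector)
open import Relation.Binary.PropositionalEquality.Core using (_≡_)
open import Relation.Nullary using (¬_; yes; no; does; _×-dec_)

data Literal (n : ℕ) : Set where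
  pos neg : Fin n → Literal n

-- The same literal may occur at several clause indices.
Formula : ℕ → ℕ → Set
Formula n m = Vector (Literal n) m

value : ∀ {n} → Vector Bool n → Literal n → Bool
value x (pos i) = x i
value x (neg i) = not (x i)

Satisfiable : ∀ {n m} → Formula n m → Set
Satisfiable {n} Φ = ∃[ x ] (∀ j → value {n} x (Φ j) ≡ true)

IsProbabilistic : ∀ {n} → Vector ℚ n → Set
IsProbabilistic a = ∀ i → 0ℚ ≤ a i × a i ≤ 1ℚ

-- A machine with integer words can only write down rational probabilities.
record Query (n : ℕ) : Set where
  constructor mkQuery
  field
    prob   : Vector ℚ n
    isProb : IsProbabilistic prob

open Query public

prTrue : ∀ {n} → Query n → Literal n → ℚ
prTrue a (pos i) = prob a i
prTrue a (neg i) = 1ℚ - prob a i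

violation : ∀ {n} → Query n → Literal n → ℚ
violation a ℓ = 1ℚ - prTrue a ℓ

data Reply (m : ℕ) : Set where
  satisfied : Reply m
  violated  : Fin m → Reply m

NoViolation : ∀ {n m} → Formula n m → Query n → Set
NoViolation Φ a = ∀ j → violation a (Φ j) ≡ 0ℚ

data Valid {n m} (Φ : Formula n m) (a : Query n) : Reply m → Set where
  satisfied : NoViolation Φ a → Valid Φ a satisfied
  violated  : ∀ {j} → ¬ NoViolation Φ a →
              (∀ k → violation a (Φ k) ≤ violation a (Φ j)) →
              Valid Φ a (violated j)

-- The reply may depend on all earlier queries (most recent first), so ties can
-- be broken adaptively, and differently when a query is repeated.
record Oracle {n m} (Φ : Formula n m) : Set where
  field
    reply : List (Query n) → Query n → Reply m
    valid : ∀ past a → Valid Φ a (reply past a)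

-- A uniform-cost random access machine: natural-number registers and arrays,
-- addition and truncated subtraction (no multiplication, as usual under unit
-- cost), indirect addressing, and structured control flow.  Registers and arrays
-- are named by numerals in the program text.

Reg Arr : Set
Reg = ℕ
Arr = ℕ

data Instr : Set where
  const   : Reg → ℕ → Instr                                -- r := k
  move    : Reg → Reg → Instr                              -- r := s
  add sub : Reg → Reg → Reg → Instr                        -- r := s ± t
  load    : Reg → Arr → Reg → Instr                        -- r := A[s]
  store   : Arr → Reg → Reg → Instr                        -- A[r] := s
  ifless  : Reg → Reg → List Instr → List Instr → Instr    -- if r < s
  while   : Reg → Reg → List Instr → Instr                 -- while r < s
  -- query A d r: ask the assignment a(i) = A[i] / d, put the coded reply in r.
  query   : Arr → Reg → Reg → Instr

Program : Set
Program = List Instr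

record State : Set where
  constructor mkState
  field
    reg : Reg → ℕ
    arr : Arr → ℕ → ℕ

open State public

_[_↦_] : ∀ {A : Set} → (ℕ → A) → ℕ → A → (ℕ → A)
(f [ k ↦ v ]) l = if does (l ≟ k) then v else f l

setReg : Reg → ℕ → State → State
setReg r v σ = record σ { reg = reg σ [ r ↦ v ] }

setArr : Arr → ℕ → ℕ → State → State
setArr A k v σ = record σ { arr = arr σ [ A ↦ arr σ A [ k ↦ v ] ] }

-- Fails when the denominator is zero or some entry lies outside [0,1].
readQuery : ∀ n → Arr → Reg → State → Maybe (Query n)
readQuery n A d σ with reg σ d
... | zero  = nothing
... | suc e with all? (λ i → (0ℚ ≤? entry i) ×-dec (entry i ≤? 1ℚ))
  where
  entry : Vector ℚ n
  entry i = + arr σ A (toℕ i) / suc e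
...   | yes p = just (mkQuery _ p)
...   | no _  = nothing

code : ∀ {m} → Reply m → ℕ
code satisfied    = 0
code (violated j) = suc (toℕ j)

record Config (n : ℕ) : Set where
  constructor ⟨_,_,_⟩
  field
    todo  : Program
    state : State
    past  : List (Query n)

-- One unit of time.  There is no next configuration when the program has ended
-- or when it attempts a malformed query.
step : ∀ {n m} {Φ : Formula n m} → Oracle Φ → Config n → Maybe (Config n)
step O ⟨ [] , σ , h ⟩ = nothing
step O ⟨ const r k ∷ P , σ , h ⟩ = just ⟨ P , setReg r k σ , h ⟩
step O ⟨ move r s ∷ P , σ , h ⟩ = just ⟨ P , setReg r (reg σ s) σ , h ⟩
step O ⟨ add r s t ∷ P , σ , h ⟩ = just ⟨ P , setReg r (reg σ s + reg σ t) σ , h ⟩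
step O ⟨ sub r s t ∷ P , σ , h ⟩ = just ⟨ P , setReg r (reg σ s ∸ reg σ t) σ , h ⟩
step O ⟨ load r A s ∷ P , σ , h ⟩ = just ⟨ P , setReg r (arr σ A (reg σ s)) σ , h ⟩
step O ⟨ store A r s ∷ P , σ , h ⟩ = just ⟨ P , setArr A (reg σ r) (reg σ s) σ , h ⟩
step O ⟨ ifless r s B C ∷ P , σ , h ⟩ =
  just ⟨ (if reg σ r <ᵇ reg σ s then B else C) ++ P , σ , h ⟩
step O ⟨ while r s B ∷ P , σ , h ⟩ =
  just ⟨ (if reg σ r <ᵇ reg σ s then B ++ while r s B ∷ P else P) , σ , h ⟩
step {n} O ⟨ query A d r ∷ P , σ , h ⟩ with readQuery n A d σ
... | nothing = nothing
... | just a  = just ⟨ P , setReg r (code (Oracle.reply O h a)) σ , a ∷ h ⟩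

data _⊢_⇓[_]_ {n m} {Φ : Formula n m} (O : Oracle Φ) : Config n → ℕ → State → Set where
  halt : ∀ {σ h} → O ⊢ ⟨ [] , σ , h ⟩ ⇓[ 0 ] σ
  next : ∀ {c c′ t σ} → step O c ≡ just c′ → O ⊢ c′ ⇓[ t ] σ → O ⊢ c ⇓[ suc t ] σ

-- The sizes n and m are the only input besides the oracle.
initial : ∀ n (m : ℕ) → Program → Config n
initial n m P = ⟨ P , mkState (((λ _ → 0) [ 0 ↦ n ]) [ 1 ↦ m ]) (λ _ _ → 0) , [] ⟩

-- The verdict is left in register 0.
CorrectVerdict : ∀ {n m} → Formula n m → State → Set
CorrectVerdict Φ σ = (reg σ 0 ≡ 1 × Satisfiable Φ) ⊎ (reg σ 0 ≡ 0 × ¬ Satisfiable Φ)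

{-# OPTIONS --safe #-}

-- Walk through the assignments x in lexicographic order, skipping as many as possible.  Each x is
-- queried twice: as it stands, which detects a model, and in a graded form in which the literals
-- false under x are violated with probability above 1/2, the more so the earlier their variable,
-- and the true ones with probability below 1/2.  Let j be the reply to the graded query.  If j was
-- never seen before, go to the successor of x.  If j was the graded reply to an earlier y, let d be
-- the first bit where y and x differ, so y_d = 0 and x_d = 1.  Suppose a model agrees with x on
-- the bits below d.  If x_d were a clause then clause j, being worst under y, would be x_d; but j is
-- worst, hence false, under x.  So setting bit d of the model to 0 gives another model, which comes
-- before x.  Hence no model agrees with x below d, and the walk may carry into a bit below d.  The
-- first bit changed since j was first seen (n while j is unseen) decreases each time j is the
-- reply, so there are at most mn + 1 rounds, of O(n) steps each.
module Submission where

open import Defs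
open import Data.Nat using (ℕ; suc; _*_; _^_; _≤_)
open import Data.Product using (Σ-syntax; ∃-syntax; _×_)
open import Data.Bool.Base using (Bool; true; false; not; if_then_else_; T)
open import Data.Bool.Properties using (not-involutive)
open import Data.Fin.Base as Fin using (Fin; toℕ; fromℕ<)
open import Data.Fin.Properties as Fin using (all?; toℕ<n; fromℕ<-toℕ)
open import Data.Integer.Base as ℤ using (+_)
import Data.Integer.Properties as ℤ
open import Data.List.Base using ([]; _∷_; _++_)
open import Data.Maybe.Base using (just)
open import Data.Nat using (zero; pred; _+_; _∸_; _<_; _<ᵇ_; _≡ᵇ_; z≤n; s≤s; s≤s⁻¹; >-nonZero)
open import Data.Nat.Properties
open import Data.Nat.Tactic.RingSolver using (solve-∀)
open import Data.Product using (_,_; proj₁; proj₂)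
open import Data.Rational.Base as ℚ using (ℚ; 0ℚ; 1ℚ)
import Data.Rational.Properties as ℚ
import Data.Rational.Unnormalised.Base as ℚᵘ
import Data.Rational.Unnormalised.Properties as ℚᵘ
open import Data.Sum using (inj₁; inj₂)
open import Data.Vec.Functional using (Vector; foldr)
open import Function using (_∘_)
open import Relation.Binary.Definitions using (tri<; tri≈; tri>)
open import Relation.Binary.PropositionalEquality
open import Relation.Nullary using (¬_; yes; no; does; contradiction; _×-dec_)
open import Relation.Nullary.Decidable using (dec-true; dec-false)

-- Fractions over a common denominator.

frac : ℕ → ℕ → ℚ
frac d x = + x ℚ./ suc d

frac-mono-≤ : ∀ d {x y} → x ≤ y → frac d x ℚ.≤ frac d y
frac-mono-≤ d {x} {y} x≤y = ℚ.toℚᵘ-cancel-≤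
  (ℚᵘ.≤-respˡ-≃ (ℚᵘ.≃-sym (ℚ.toℚᵘ-fromℚᵘ (ℚᵘ.mkℚᵘ (+ x) d)))
    (ℚᵘ.≤-respʳ-≃ (ℚᵘ.≃-sym (ℚ.toℚᵘ-fromℚᵘ (ℚᵘ.mkℚᵘ (+ y) d)))
      (ℚᵘ.*≤* (ℤ.*-monoʳ-≤-nonNeg (+ suc d) (ℤ.+≤+ x≤y)))))

frac-cancel-≤ : ∀ d {x y} → frac d x ℚ.≤ frac d y → x ≤ y
frac-cancel-≤ d {x} {y} le = ℤ.drop‿+≤+ (ℤ.*-cancelʳ-≤-pos (+ x) (+ y) (+ suc d)
  (ℚᵘ.drop-*≤*
    (ℚᵘ.≤-respˡ-≃ (ℚ.toℚᵘ-fromℚᵘ (ℚᵘ.mkℚᵘ (+ x) d))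
      (ℚᵘ.≤-respʳ-≃ (ℚ.toℚᵘ-fromℚᵘ (ℚᵘ.mkℚᵘ (+ y) d)) (ℚ.toℚᵘ-mono-≤ le)))))

frac-zero : ∀ d → frac d 0 ≡ 0ℚ
frac-zero d = ℚ.0/n≡0 (suc d)

frac-one : ∀ d → frac d (suc d) ≡ 1ℚ
frac-one d = ℚ.fromℚᵘ-cong {ℚᵘ.mkℚᵘ (+ suc d) d} {ℚᵘ.1ℚᵘ} (ℚᵘ.*≡* (ℤ.*-comm (+ suc d) (+ 1)))

frac-+ : ∀ {d} x y → frac d x ℚ.+ frac d y ≡ frac d (x + y)
frac-+ {d} x y = ℚ.toℚᵘ-injective (begin
  ℚ.toℚᵘ (frac d x ℚ.+ frac d y)             ≈⟨ ℚ.toℚᵘ-homo-+ (frac d x) (frac d y) ⟩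
  ℚ.toℚᵘ (frac d x) ℚᵘ.+ ℚ.toℚᵘ (frac d y)   ≈⟨ ℚᵘ.+-cong (ℚ.toℚᵘ-fromℚᵘ (u x)) (ℚ.toℚᵘ-fromℚᵘ (u y)) ⟩
  u x ℚᵘ.+ u y                               ≈⟨ ℚᵘ.*≡* same ⟩
  u (x + y)                                  ≈⟨ ℚ.toℚᵘ-fromℚᵘ (u (x + y)) ⟨
  ℚ.toℚᵘ (frac d (x + y))                    ∎)
  where
  open ℚᵘ.≃-Reasoning
  u = λ z → ℚᵘ.mkℚᵘ (+ z) d
  D = + suc d
  same : (+ x ℤ.* D ℤ.+ + y ℤ.* D) ℤ.* D ≡ + (x + y) ℤ.* (+ (suc d * suc d))
  same = trans (cong (ℤ._* D) (sym (ℤ.*-distribʳ-+ D (+ x) (+ y))))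
    (trans (ℤ.*-assoc (+ (x + y)) D D) (cong (+ (x + y) ℤ.*_) (sym (ℤ.pos-* (suc d) (suc d)))))

1-frac : ∀ {d x} → x ≤ suc d → 1ℚ ℚ.- frac d x ≡ frac d (suc d ∸ x)
1-frac {d} {x} x≤ = begin
  1ℚ ℚ.- frac d x                                  ≡⟨ cong (ℚ._- frac d x) (sym split) ⟩
  (frac d (suc d ∸ x) ℚ.+ frac d x) ℚ.- frac d x   ≡⟨ ℚ.+-assoc (frac d (suc d ∸ x)) (frac d x) _ ⟩
  frac d (suc d ∸ x) ℚ.+ (frac d x ℚ.- frac d x)   ≡⟨ cong (frac d (suc d ∸ x) ℚ.+_) (ℚ.+-inverseʳ (frac d x)) ⟩
  frac d (suc d ∸ x) ℚ.+ 0ℚ                        ≡⟨ ℚ.+-identityʳ _ ⟩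
  frac d (suc d ∸ x)                               ∎
  where
  open ≡-Reasoning
  split : frac d (suc d ∸ x) ℚ.+ frac d x ≡ 1ℚ
  split = trans (frac-+ (suc d ∸ x) x) (trans (cong (frac d) (m∸n+n≡m x≤)) (frac-one d))

-- The violation probability of a literal is this over D in the query a(i) = b i / D.
numerator : ∀ {n} → ℕ → (ℕ → ℕ) → Literal n → ℕ
numerator D b (pos i) = D ∸ b (toℕ i)
numerator D b (neg i) = b (toℕ i)

violation-frac : ∀ {n d b} (a : Query n) →
  (∀ i → b (toℕ i) ≤ suc d) → (∀ i → prob a i ≡ frac d (b (toℕ i))) →
  ∀ ℓ → violation a ℓ ≡ frac d (numerator (suc d) b ℓ)
violation-frac a b≤ a≡ (pos i) = trans (cong (ℚ._-_ 1ℚ) (a≡ i)) (1-frac (b≤ i))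
violation-frac {d = d} {b} a b≤ a≡ (neg i) = begin
  1ℚ ℚ.- (1ℚ ℚ.- prob a i)              ≡⟨ cong (ℚ._-_ 1ℚ) (trans (cong (ℚ._-_ 1ℚ) (a≡ i)) (1-frac (b≤ i))) ⟩
  1ℚ ℚ.- frac d (suc d ∸ b (toℕ i))     ≡⟨ 1-frac (m∸n≤m (suc d) (b (toℕ i))) ⟩
  frac d (suc d ∸ (suc d ∸ b (toℕ i)))  ≡⟨ cong (frac d) (m∸[m∸n]≡n (b≤ i)) ⟩
  frac d (b (toℕ i))                    ∎
  where open ≡-Reasoning

readQuery-succeeds : ∀ n A r {σ d} → reg σ r ≡ suc d → (∀ (i : Fin n) → arr σ A (toℕ i) ≤ suc d) →
  ∃[ a ] (readQuery n A r σ ≡ just a × (∀ i → prob a i ≡ frac d (arr σ A (toℕ i))))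
readQuery-succeeds n A r {σ} {d} r≡ A≤ with reg σ r | r≡
... | .(suc d) | refl with all? (λ (i : Fin n) →
      (0ℚ ℚ.≤? frac d (arr σ A (toℕ i))) ×-dec (frac d (arr σ A (toℕ i)) ℚ.≤? 1ℚ))
...   | yes p = _ , refl , λ _ → refl
...   | no ¬p = contradiction
  (λ i → subst (ℚ._≤ frac d (arr σ A (toℕ i))) (frac-zero d) (frac-mono-≤ d {0} {arr σ A (toℕ i)} z≤n)
       , subst (frac d (arr σ A (toℕ i)) ℚ.≤_) (frac-one d) (frac-mono-≤ d (A≤ i))) ¬p

-- Updates, comparisons and timed execution.

updated-same : ∀ {A : Set} (f : ℕ → A) k v → (f [ k ↦ v ]) k ≡ v
updated-same f k v = cong (if_then v else f k) (dec-true (k ≟ k) refl)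

updated-other : ∀ {A : Set} (f : ℕ → A) {k l} v → l ≢ k → (f [ k ↦ v ]) l ≡ f l
updated-other f {k} {l} v l≢k = cong (if_then v else f l) (dec-false (l ≟ k) l≢k)

<ᵇ-true : ∀ {m n} → m < n → (m <ᵇ n) ≡ true
<ᵇ-true {m} {n} m<n with m <ᵇ n | <⇒<ᵇ m<n
... | true | _ = refl

<ᵇ-false : ∀ {m n} → n ≤ m → (m <ᵇ n) ≡ false
<ᵇ-false {m} {n} n≤m with m <ᵇ n in eq
... | false = refl
... | true = contradiction n≤m (<⇒≱ (<ᵇ⇒< m n (subst T (sym eq) _)))

-- Clears the common denominator `D` from `Valid`, so that the search compares natural numbers only.
data Answer {n m} (Φ : Formula n m) (D : ℕ) (b : ℕ → ℕ) : Reply m → Set where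
  satisfied : (∀ j → numerator D b (Φ j) ≡ 0) → Answer Φ D b satisfied
  violated  : ∀ {j} → ¬ (∀ k → numerator D b (Φ k) ≡ 0) →
              (∀ k → numerator D b (Φ k) ≤ numerator D b (Φ j)) → Answer Φ D b (violated j)

step-query : ∀ {n m} {Φ : Formula n m} (O : Oracle Φ) {A d r P σ h a} → readQuery n A d σ ≡ just a →
  step O ⟨ query A d r ∷ P , σ , h ⟩ ≡ just ⟨ P , setReg r (code (Oracle.reply O h a)) σ , a ∷ h ⟩
step-query O eq rewrite eq = refl

module Run {n m} {Φ : Formula n m} (O : Oracle Φ) where

  -- A continuation-passing reading of the semantics: T bounds the time left.
  record Decides (c : Config n) (T : ℕ) : Set where
    constructor decides
    field
      {time}  : ℕ
      {final} : State
      run     : O ⊢ c ⇓[ time ] final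
      time≤   : time ≤ T
      correct : CorrectVerdict Φ final

  halted : ∀ {σ h T} → CorrectVerdict Φ σ → Decides ⟨ [] , σ , h ⟩ T
  halted v = decides halt z≤n v

  tick : ∀ {c c′ T} → step O c ≡ just c′ → Decides c′ T → Decides c (suc T)
  tick eq (decides r t v) = decides (next eq r) (s≤s t) v

  relax : ∀ {c T T′} → T ≤ T′ → Decides c T → Decides c T′
  relax le (decides r t v) = decides r (≤-trans t le) v

  ifless-true : ∀ {r s B C P σ h T} → reg σ r < reg σ s →
    Decides ⟨ B ++ P , σ , h ⟩ T → Decides ⟨ ifless r s B C ∷ P , σ , h ⟩ (suc T)
  ifless-true {B = B} {C} {P} {σ} {h} lt =
    tick (cong (λ b → just ⟨ (if b then B else C) ++ P , σ , h ⟩) (<ᵇ-true lt))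

  ifless-false : ∀ {r s B C P σ h T} → reg σ s ≤ reg σ r →
    Decides ⟨ C ++ P , σ , h ⟩ T → Decides ⟨ ifless r s B C ∷ P , σ , h ⟩ (suc T)
  ifless-false {B = B} {C} {P} {σ} {h} ge =
    tick (cong (λ b → just ⟨ (if b then B else C) ++ P , σ , h ⟩) (<ᵇ-false ge))

  while-true : ∀ {r s B P σ h T} → reg σ r < reg σ s →
    Decides ⟨ B ++ while r s B ∷ P , σ , h ⟩ T → Decides ⟨ while r s B ∷ P , σ , h ⟩ (suc T)
  while-true {r} {s} {B} {P} {σ} {h} lt =
    tick (cong (λ b → just ⟨ (if b then B ++ while r s B ∷ P else P) , σ , h ⟩) (<ᵇ-true lt))

  while-false : ∀ {r s B P σ h T} → reg σ s ≤ reg σ r →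
    Decides ⟨ P , σ , h ⟩ T → Decides ⟨ while r s B ∷ P , σ , h ⟩ (suc T)
  while-false {r} {s} {B} {P} {σ} {h} ge =
    tick (cong (λ b → just ⟨ (if b then B ++ while r s B ∷ P else P) , σ , h ⟩) (<ᵇ-false ge))

  answer : ∀ {d b} (a : Query n) → (∀ ℓ → violation a ℓ ≡ frac d (numerator (suc d) b ℓ)) →
    ∀ {ρ} → Valid Φ a ρ → Answer Φ (suc d) b ρ
  answer {d} {b} a viol = translate
    where
    num : Fin m → ℕ
    num k = numerator (suc d) b (Φ k)
    zero⇒ : NoViolation Φ a → ∀ k → num k ≡ 0
    zero⇒ none k = n≤0⇒n≡0 (frac-cancel-≤ d
      (ℚ.≤-reflexive (trans (sym (viol (Φ k))) (trans (none k) (sym (frac-zero d))))))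
    zero⇐ : (∀ k → num k ≡ 0) → NoViolation Φ a
    zero⇐ none k = trans (viol (Φ k)) (trans (cong (frac d) (none k)) (frac-zero d))
    translate : ∀ {ρ} → Valid Φ a ρ → Answer Φ (suc d) b ρ
    translate (satisfied none) = satisfied (zero⇒ none)
    translate (violated {j} some worst) = violated (λ none → some (zero⇐ none))
      (λ k → frac-cancel-≤ d (subst₂ ℚ._≤_ (viol (Φ k)) (viol (Φ j)) (worst k)))

  -- The continuation has to cope with every valid reply and every history, so it does not matter
  -- how an adaptive oracle breaks ties.
  ask : ∀ {A d r P σ h T D} → reg σ d ≡ suc D → (∀ (i : Fin n) → arr σ A (toℕ i) ≤ suc D) →
    (∀ ρ h′ → Answer Φ (suc D) (arr σ A) ρ → Decides ⟨ P , setReg r (code ρ) σ , h′ ⟩ T) →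
    Decides ⟨ query A d r ∷ P , σ , h ⟩ (suc T)
  ask {A} {d} {r} {P} {σ} {h} d≡ A≤ k with readQuery-succeeds n A d {σ} d≡ A≤
  ... | a , eq , prob≡ = tick (step-query O {A} {d} {r} {P} {σ} eq)
    (k (Oracle.reply O h a) (a ∷ h) (answer a (violation-frac {b = arr σ A} a A≤ prob≡) (Oracle.valid O h a)))

-- Bit strings, successors and time stamps.

AgreeBelow : ℕ → (ℕ → Bool) → (ℕ → Bool) → Set
AgreeBelow k x y = ∀ i → i < k → x i ≡ y i

-- When `x q` is false, this is the least string after all those that share bits 0 to `q` with `x`;
-- bit 0 is the most significant.
increment : ℕ → (ℕ → Bool) → (ℕ → Bool)
increment q x i = if i <ᵇ q then x i else (i ≡ᵇ q)

-- Bits above `q` are stamped even if they were 0 before, so that the bits written since a given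
-- time always form a suffix.
stampFrom : ℕ → ℕ → (ℕ → ℕ) → (ℕ → ℕ)
stampFrom q t c i = if i <ᵇ q then c i else t

module _ {q : ℕ} {x : ℕ → Bool} where

  increment-below : ∀ {i} → i < q → increment q x i ≡ x i
  increment-below {i} i<q = cong (if_then x i else (i ≡ᵇ q)) (<ᵇ-true i<q)

  increment-at : increment q x q ≡ true
  increment-at = trans (cong (if_then x q else (q ≡ᵇ q)) (<ᵇ-false (≤-refl {q}))) (dec-true (q ≟ q) refl)

  increment-above : ∀ {i} → q < i → increment q x i ≡ false
  increment-above {i} q<i = trans (cong (if_then x i else (i ≡ᵇ q)) (<ᵇ-false (<⇒≤ q<i)))
    (dec-false (i ≟ q) (<⇒≢ q<i ∘ sym))

module _ {q t : ℕ} {c : ℕ → ℕ} where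

  stampFrom-below : ∀ {i} → i < q → stampFrom q t c i ≡ c i
  stampFrom-below {i} i<q = cong (if_then c i else t) (<ᵇ-true i<q)

  stampFrom-above : ∀ {i} → q ≤ i → stampFrom q t c i ≡ t
  stampFrom-above {i} q≤i = cong (if_then c i else t) (<ᵇ-false q≤i)

-- Sums over the clauses.

total : ∀ {m} → Vector ℕ m → ℕ
total = foldr _+_ 0

total-mono-≤ : ∀ {m} {f g : Vector ℕ m} → (∀ i → f i ≤ g i) → total f ≤ total g
total-mono-≤ {zero}  f≤g = z≤n
total-mono-≤ {suc m} f≤g = +-mono-≤ (f≤g Fin.zero) (total-mono-≤ (f≤g ∘ Fin.suc))

total-mono-< : ∀ {m} {f g : Vector ℕ m} → (∀ i → f i ≤ g i) → ∀ j → f j < g j → total f < total g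
total-mono-< f≤g Fin.zero    lt = +-mono-<-≤ lt (total-mono-≤ (f≤g ∘ Fin.suc))
total-mono-< f≤g (Fin.suc j) lt = +-mono-≤-< (f≤g Fin.zero) (total-mono-< (f≤g ∘ Fin.suc) j lt)

total-const : ∀ m n → total {m} (λ _ → n) ≡ m * n
total-const zero    n = refl
total-const (suc m) n = cong (_+_ n) (total-const m n)

-- Graded weights and the invariant of the walk.

module Search {n m} (Φ : Formula n m) where

  var : Literal n → Fin n
  var (pos i) = i
  var (neg i) = i

  holds : (ℕ → Bool) → Literal n → Bool
  holds x = value (x ∘ toℕ)

  Models : (ℕ → Bool) → Set
  Models x = ∀ j → holds x (Φ j) ≡ true

  holds-cong : ∀ {x y} ℓ → x (toℕ (var ℓ)) ≡ y (toℕ (var ℓ)) → holds x ℓ ≡ holds y ℓ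
  holds-cong (pos i) eq = eq
  holds-cong (neg i) eq = cong not eq

  extend : (Fin n → Bool) → ℕ → Bool
  extend x i with i <? n
  ... | yes i<n = x (fromℕ< i<n)
  -- No literal reads a position from `n` on, so any default would do.
  ... | no _    = false

  extend-toℕ : ∀ x i → extend x (toℕ i) ≡ x i
  extend-toℕ x i with toℕ i <? n
  ... | yes i<n = cong x (fromℕ<-toℕ i i<n)
  ... | no i≮n  = contradiction (toℕ<n i) i≮n

  value-extend : ∀ x ℓ → holds (extend x) ℓ ≡ value x ℓ
  value-extend x (pos i) = extend-toℕ x i
  value-extend x (neg i) = cong not (extend-toℕ x i)

  unsatisfiable : (∀ x → ¬ Models x) → ¬ Satisfiable Φ
  unsatisfiable none (x , sat) = none (extend x) (λ j → trans (value-extend x (Φ j)) (sat j))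

  -- In the graded query of x, a literal on variable i is violated with
  -- probability 1 - i/2n if it is false under x, and i/2n if it is true.
  rank : Bool → ℕ → ℕ
  rank true  i = n + n ∸ i
  rank false i = i

  weight : (ℕ → Bool) → Literal n → ℕ
  weight x ℓ = rank (not (holds x ℓ)) (toℕ (var ℓ))

  Worst : (ℕ → Bool) → Fin m → Set
  Worst x j = ∀ k → weight x (Φ k) ≤ weight x (Φ j)

  rank-true : ∀ {i} → i < n → n < rank true i
  rank-true {i} i<n = m+n≤o⇒m≤o∸n (suc n) (+-monoʳ-< n i<n)

  weight-true : ∀ {x ℓ} → holds x ℓ ≡ true → weight x ℓ < n
  weight-true {x} {ℓ} eq rewrite eq = toℕ<n (var ℓ)

  weight-< : ∀ {x ℓ} → weight x ℓ < n → holds x ℓ ≡ true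
  weight-< {x} {ℓ} w<n with holds x ℓ
  ... | true  = refl
  ... | false = contradiction (rank-true (toℕ<n (var ℓ))) (<⇒≯ w<n)

  -- True literals weigh less than `n` and false ones more, so a worst clause that is true leaves no
  -- room for a false one.
  worst-true : ∀ {x j} → Worst x j → holds x (Φ j) ≡ true → Models x
  worst-true {x} {j} worst eq k = weight-< {x} {Φ k} (≤-<-trans (worst k) (weight-true {x} {Φ j} eq))

  -- The lexicographic order on the first `n` bits.
  _≺_ : (ℕ → Bool) → (ℕ → Bool) → Set
  x ≺ y = ∃[ d ] (d < n × AgreeBelow d x y × x d ≡ false × y d ≡ true)

  -- Clause `k` is false under `y`, hence so is the worst clause `j`, and its variable is at most
  -- `d`. A variable below `d` would make it false under the model too, which agrees with `y` there.
  -- At `d` the literal must be positive, as `y d` is false.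
  worst-at : ∀ {y d j} {i : Fin n} {x} → Worst y j → Models x → AgreeBelow d x y → y d ≡ false →
    toℕ i ≡ d → ∀ {k} → Φ k ≡ pos i → ∃[ i′ ] (Φ j ≡ pos i′ × toℕ i′ ≡ d)
  worst-at {y} {d} {j} {i} {x} worst models agree yd refl {k} Φk
    with Φ j | worst k | models j
  ... | ℓ | le | sat rewrite Φk | yd = locate ℓ le sat
    where
    locate : ∀ ℓ → rank true (toℕ i) ≤ weight y ℓ → holds x ℓ ≡ true →
      ∃[ i′ ] (ℓ ≡ pos i′ × toℕ i′ ≡ toℕ i)
    locate ℓ le sat with holds y ℓ in eq
    ... | true = contradiction (<-trans (rank-true (toℕ<n i)) (≤-<-trans le (toℕ<n (var ℓ)))) (n≮n n)
    ... | false with <-cmp (toℕ (var ℓ)) (toℕ i)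
    ...   | tri< lt _ _ = contradiction (trans (sym sat) (trans (holds-cong {x} {y} ℓ (agree _ lt)) eq)) λ ()
    ...   | tri> _ _ gt = contradiction le (<⇒≱ (∸-monoʳ-< gt (≤-trans (<⇒≤ (toℕ<n (var ℓ))) (m≤m+n n n))))
    locate (pos i′) le sat | false | tri≈ _ same _ = i′ , refl , same
    locate (neg i′) le sat | false | tri≈ _ same _ =
      contradiction (trans (sym eq) (cong not (trans (cong y same) yd))) λ ()

  -- If x_d were a clause, then clause j, worst under y, would be x_d; as x_d holds under z and
  -- j is worst under z too, z would be a model.
  absent : ∀ {x y z d j} → Worst y j → Worst z j → ¬ Models z → Models x →
    AgreeBelow d x y → y d ≡ false → z d ≡ true → Models (x [ d ↦ false ])
  absent {x} {y} {z} {d} {j} worst-y worst-z ¬z models agree yd zd k = go (Φ k) refl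
    where
    go : ∀ ℓ → Φ k ≡ ℓ → holds (x [ d ↦ false ]) ℓ ≡ true
    go ℓ Φk with toℕ (var ℓ) ≟ d
    go ℓ Φk | no ≢d = trans (holds-cong {x [ d ↦ false ]} {x} ℓ (updated-other x false ≢d))
      (subst (λ l → holds x l ≡ true) Φk (models k))
    go (pos i) Φk | yes ≡d with worst-at worst-y models agree yd ≡d Φk
    ... | i′ , Φj , ≡d′ = contradiction
      (worst-true {z} {j} worst-z (trans (cong (holds z) Φj) (trans (cong z ≡d′) zd))) ¬z
    go (neg i) Φk | yes refl = cong not (updated-same x d false)

  -- c i is the time when bit i was last written.  A seen clause was worst under some earlier
  -- assignment y, at time s, and e is the first bit written since.
  data Log (x : ℕ → Bool) (c : ℕ → ℕ) (now : ℕ) (j : Fin m) : ℕ → ℕ → Set where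
    fresh : Log x c now j 0 n
    seen  : ∀ {s e} y → 0 < s → s < now → e < n → Worst y j →
      (∀ {i} → i < e → c i ≤ s) → AgreeBelow e y x →
      (∀ {i} → e ≤ i → i < n → s < c i) → y e ≡ false → x e ≡ true → Log x c now j s e

  -- `started` keeps stamp 0 free to mean unseen, and `S` is indexed by reply codes, hence the
  -- `suc`. The sum of the `e j` is the potential that falls in every round.
  record Invariant (x : ℕ → Bool) (c : ℕ → ℕ) (now : ℕ) (S : ℕ → ℕ) (e : Fin m → ℕ) : Set where
    field
      minimal : ∀ {x′} → Models x′ → ¬ x′ ≺ x
      past    : ∀ i → c i ≤ now
      started : 0 < now
      logged  : ∀ j → Log x c now j (S (suc (toℕ j))) (e j)

  open Invariant public

  -- The carry goes into the last 0 not written after time `s`. The index is its position plus one,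
  -- so that 0 can mean that there is none.
  data Scanned (x : ℕ → Bool) (c : ℕ → ℕ) (s k : ℕ) : ℕ → Set where
    none : (∀ {i} → i < k → c i ≤ s → x i ≡ true) → Scanned x c s k 0
    last : ∀ {q} → q < k → c q ≤ s → x q ≡ false →
      (∀ {i} → q < i → i < k → c i ≤ s → x i ≡ true) → Scanned x c s k (suc q)

  scanned-true : ∀ {x c s k z} → Scanned x c s k z → ∀ {i} → z ≤ i → i < k → c i ≤ s → x i ≡ true
  scanned-true (none all) _ = all
  scanned-true (last _ _ _ all) = all

  module _ {x : ℕ → Bool} (minimal : ∀ {x′} → Models x′ → ¬ x′ ≺ x) where

    -- At a first disagreement between `z` and `L` the model would have 0 where `x` has 1, and so
    -- would come before `x`.
    agree-further : ∀ {z L x′} → L ≤ n → (∀ {i} → z ≤ i → i < L → x i ≡ true) → Models x′ →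
      AgreeBelow z x′ x → ∀ k → k ≤ L → AgreeBelow k x′ x
    agree-further L≤n ones models agree (suc k) k<L i i<1+k with m≤n⇒m<n∨m≡n (s≤s⁻¹ i<1+k)
    ... | inj₁ i<k = agree-further L≤n ones models agree k (<⇒≤ k<L) i i<k
    agree-further {z} {x′ = x′} L≤n ones models agree (suc k) k<L i i<1+k | inj₂ refl with k <? z
    ... | yes k<z = agree k k<z
    ... | no k≮z with x′ k in x′k
    ...   | true  = sym (ones (≮⇒≥ k≮z) k<L)
    ...   | false = contradiction
      (k , <-≤-trans k<L L≤n , agree-further L≤n ones models agree k (<⇒≤ k<L) , x′k , ones (≮⇒≥ k≮z) k<L)
      (minimal models)

    -- Consider where the model first falls below the successor. Before `q`, it would lie before
    -- `x`; after `q`, the successor has only zeros; at `q`, the model has 0 and so agrees with `x`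
    -- through bit `q`.
    minimal-increment : ∀ {q} → x q ≡ false → (∀ {x′} → Models x′ → ¬ AgreeBelow (suc q) x′ x) →
      ∀ {x′} → Models x′ → ¬ x′ ≺ increment q x
    minimal-increment {q} xq stuck {x′} models (d , d<n , agree , x′d , xd) with <-cmp d q
    ... | tri< d<q _ _ = minimal models
      (d , d<n , (λ i i<d → trans (agree i i<d) (increment-below {x = x} (<-trans i<d d<q))) , x′d
      , trans (sym (increment-below {x = x} d<q)) xd)
    ... | tri> _ _ q<d = contradiction (trans (sym (increment-above {x = x} q<d)) xd) λ ()
    ... | tri≈ _ refl _ = stuck models agree′
      where
      agree′ : AgreeBelow (suc q) x′ x
      agree′ i i<1+q with m≤n⇒m<n∨m≡n (s≤s⁻¹ i<1+q)
      ... | inj₁ i<q  = trans (agree i i<q) (increment-below {x = x} i<q)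
      ... | inj₂ refl = trans x′d (sym xq)

  module _ {x c now S e j} (inv : Invariant x c now S e) (¬x : ¬ Models x) (worst : Worst x j) where

    -- No model begins with the first `limit` bits of `x`. The machine does not store `limit`; it
    -- recognises these bits by their stamps, which are at most `s`.
    record Blocked (s : ℕ) : Set where
      field
        limit  : ℕ
        limit≤ : limit ≤ n
        stamps : ∀ {i} → i < limit → c i ≤ s
        stuck  : ∀ {x′} → Models x′ → ¬ AgreeBelow limit x′ x

    -- A first reply `j` rules out nothing beyond `x` itself, so the prefix is all of `x`.
    blocked-fresh : Blocked now
    blocked-fresh = record
      { limit = n ; limit≤ = ≤-refl ; stamps = λ {i} _ → past inv i
      ; stuck = λ {x′} models agree → ¬x λ k →
          trans (sym (holds-cong {x′} {x} (Φ k) (agree _ (toℕ<n (var (Φ k)))))) (models k) }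

    blocked-seen : ∀ {s e} → 0 < s → Log x c now j s e → Blocked s
    blocked-seen () fresh
    blocked-seen _ (seen {e = e} y _ _ e<n worst-y c≤s y≡x _ ye xe) = record
      { limit = e ; limit≤ = <⇒≤ e<n ; stamps = c≤s ; stuck = stuck }
      where
      stuck : ∀ {x′} → Models x′ → ¬ AgreeBelow e x′ x
      stuck {x′} models agree = minimal inv
        (absent worst-y worst ¬x models (λ i i<e → trans (agree i i<e) (sym (y≡x i i<e))) ye xe)
        (e , e<n , (λ i i<e → trans (updated-other x′ false (<⇒≢ i<e)) (agree i i<e)) , updated-same x′ e false , xe)

    -- From `z` up to the limit `x` has only ones, so by minimality agreement below `z` extends to
    -- the limit.
    scanned-stuck : ∀ {s z} → Blocked s → Scanned x c s n z → ∀ {x′} → Models x′ → ¬ AgreeBelow z x′ x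
    scanned-stuck blocked scan models agree = stuck models
      (agree-further (minimal inv) limit≤
        (λ z≤i i<L → scanned-true scan z≤i (<-≤-trans i<L limit≤) (stamps i<L))
        models agree limit ≤-refl)
      where open Blocked blocked

    module _ {q} (q<n : q < n) (xq : x q ≡ false) where

      private
        x⁺ = increment q x
        c⁺ = stampFrom q (suc now) c

      -- For a seen clause, the first bit written since `s` becomes the smaller of `e` and `q`,
      -- which differ because `x` is 1 at `e` and 0 at `q`. If `q` was not written after `s`, then
      -- `q` lies below `e` and the limit drops.
      relog : ∀ {k s e} → Log x c now k s e →
        ∃[ e′ ] (e′ ≤ e × Log x⁺ c⁺ (suc now) k s e′ × (0 < s → c q ≤ s → e′ < e))
      relog fresh = n , ≤-refl , fresh , λ ()
      relog {s = s} {e} (seen y 0<s s<now e<n worst-y c≤s y≡x s<c ye xe) with e <? q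
      ... | yes e<q = e , ≤-refl
        , seen y 0<s (m<n⇒m<1+n s<now) e<n worst-y
            (λ i<e → subst (_≤ s) (sym (stampFrom-below {c = c} (<-trans i<e e<q))) (c≤s i<e))
            (λ i i<e → trans (y≡x i i<e) (sym (increment-below {x = x} (<-trans i<e e<q))))
            later ye (trans (increment-below {x = x} e<q) xe)
        , λ _ cq≤s → contradiction cq≤s (<⇒≱ (s<c (<⇒≤ e<q) q<n))
        where
        later : ∀ {i} → e ≤ i → i < n → s < c⁺ i
        later {i} e≤i i<n with i <? q
        ... | yes i<q = subst (s <_) (sym (stampFrom-below {c = c} i<q)) (s<c e≤i i<n)
        ... | no i≮q  = subst (s <_) (sym (stampFrom-above {c = c} (≮⇒≥ i≮q))) (m<n⇒m<1+n s<now)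
      ... | no e≮q = q , <⇒≤ q<e
        , seen y 0<s (m<n⇒m<1+n s<now) q<n worst-y
            (λ i<q → subst (_≤ s) (sym (stampFrom-below {c = c} i<q)) (c≤s (<-trans i<q q<e)))
            (λ i i<q → trans (y≡x i (<-trans i<q q<e)) (sym (increment-below {x = x} i<q)))
            (λ q≤i _ → subst (s <_) (sym (stampFrom-above {c = c} q≤i)) (m<n⇒m<1+n s<now))
            (trans (y≡x q q<e) xq) (increment-at {q} {x})
        , λ _ _ → q<e
        where
        q<e : q < e
        q<e = ≤∧≢⇒< (≮⇒≥ e≮q) λ { refl → contradiction (trans (sym xq) xe) λ () }

      log-now : Log x⁺ c⁺ (suc now) j now q
      log-now = seen x (started inv) ≤-refl q<n worst
        (λ {i} i<q → subst (_≤ now) (sym (stampFrom-below {c = c} i<q)) (past inv i))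
        (λ i i<q → sym (increment-below {x = x} i<q))
        (λ q≤i _ → ≤-reflexive (sym (stampFrom-above {c = c} q≤i)))
        xq (increment-at {q} {x})

      past⁺ : ∀ i → c⁺ i ≤ suc now
      past⁺ i with i <? q
      ... | yes i<q = subst (_≤ suc now) (sym (stampFrom-below {c = c} i<q)) (m≤n⇒m≤1+n (past inv i))
      ... | no i≮q  = ≤-reflexive (stampFrom-above {c = c} (≮⇒≥ i≮q))

      -- Serves first and repeated replies alike: the caller supplies a log for `j` with a smaller
      -- limit, and by `relog` no other limit grows.
      proceed : ∀ {S⁺} → (∀ {i} → i ≢ suc (toℕ j) → S⁺ i ≡ S i) →
        ∃[ e′ ] (Log x⁺ c⁺ (suc now) j (S⁺ (suc (toℕ j))) e′ × e′ < e j) →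
        (∀ {x′} → Models x′ → ¬ AgreeBelow (suc q) x′ x) →
        ∃[ e⁺ ] (Invariant x⁺ c⁺ (suc now) S⁺ e⁺ × total e⁺ < total e)
      proceed {S⁺} S⁺≡ (e′ , log′ , e′<) stuck = proj₁ ∘ choose , record
        { minimal = minimal-increment (minimal inv) xq stuck
        ; past    = past⁺
        ; started = s≤s z≤n
        ; logged  = λ k → proj₁ (proj₂ (choose k))
        } , total-mono-< (λ k → proj₁ (proj₂ (proj₂ (choose k)))) j (proj₂ (proj₂ (proj₂ (choose j))) refl)
        where
        choose : ∀ k → ∃[ e″ ] (Log x⁺ c⁺ (suc now) k (S⁺ (suc (toℕ k))) e″ × e″ ≤ e k × (k ≡ j → e″ < e k))
        choose k with k Fin.≟ j
        ... | yes refl = e′ , log′ , <⇒≤ e′< , λ _ → e′<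
        ... | no k≢j with relog (logged inv k)
        ...   | e″ , e″≤ , log , _ = e″
          , subst (λ s → Log x⁺ c⁺ (suc now) k s e″)
              (sym (S⁺≡ (λ eq → k≢j (Fin.toℕ-injective (suc-injective eq))))) log
          , e″≤ , λ k≡j → contradiction k≡j k≢j

      log-fresh : ∀ {s} → Log x c now j s (e j) → s ≡ 0 → Log x⁺ c⁺ (suc now) j now q × q < e j
      log-fresh log refl = log-now , subst (q <_) (sym (limit≡ log)) q<n
        where
        limit≡ : ∀ {e} → Log x c now j 0 e → e ≡ n
        limit≡ fresh = refl

-- The program.

rsize rrun rzero rone rtwice rnow rmark rk rreply rstamp rtmp : Reg
-- Register 0 holds `n` until the verdict overwrites it. Register 1 starts as `m` and doubles as the
-- flag that keeps the main loop running.
rsize  = 0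
rrun   = 1
rzero  = 2
rone   = 3
rtwice = 4
rnow   = 5
rmark  = 6
rk     = 7
rreply = 8
rstamp = 9
rtmp   = 10

-- Replies are coded from 1, so clause j has its time stamp at position j + 1; 0 means not yet seen.
bits ranks changed stamp : Arr
bits    = 0
ranks   = 1
changed = 2
stamp   = 3

clearBody scanBody advance remember leaf search solver : Program

clearBody =
  store bits rk rzero ∷ store ranks rk rk ∷ store changed rk rnow ∷ add rk rk rone ∷ []

scanBody =
  load rtmp changed rk ∷
  ifless rstamp rtmp [] (load rtmp bits rk ∷ ifless rtmp rone (add rmark rk rone ∷ []) [] ∷ []) ∷
  add rk rk rone ∷ []

-- No stamp exceeds `rnow`, so with this `rstamp` the scan admits every bit, as a first reply
-- requires.
remember = store stamp rreply rnow ∷ move rstamp rnow ∷ []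

advance =
  sub rk rmark rone ∷ store bits rk rone ∷ sub rtmp rtwice rk ∷ store ranks rk rtmp ∷
  add rnow rnow rone ∷ store changed rk rnow ∷ []

leaf =
  query ranks rtwice rreply ∷ load rstamp stamp rreply ∷ ifless rstamp rone remember [] ∷
  const rmark 0 ∷ const rk 0 ∷ while rk rsize scanBody ∷
  ifless rzero rmark advance (const 0 0 ∷ const rrun 0 ∷ []) ∷ []

search =
  move rk rmark ∷ while rk rsize clearBody ∷ query bits rone rreply ∷
  ifless rzero rreply leaf (const 0 1 ∷ const rrun 0 ∷ []) ∷ []

solver =
  ifless rzero rrun
    (const rone 1 ∷ const rnow 1 ∷ add rtwice rsize rsize ∷ while rzero rrun search ∷ [])
    (const 0 1 ∷ []) ∷ []

-- Correctness and running time of the program.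

extend-prefix : ∀ {f g : ℕ → ℕ} {a k v} → a ≡ k → v ≡ g k → (∀ i → i < k → f i ≡ g i) →
  ∀ i → i < suc k → (f [ a ↦ v ]) i ≡ g i
extend-prefix {f} {a = a} {v = v} refl v≡ f≡g i i<1+k with m≤n⇒m<n∨m≡n (s≤s⁻¹ i<1+k)
... | inj₁ i<k  = trans (updated-other f v (<⇒≢ i<k)) (f≡g i i<k)
... | inj₂ refl = trans (updated-same f a v) v≡

bit : Bool → ℕ
bit true  = 1
bit false = 0

bit≤1 : ∀ b → bit b ≤ 1
bit≤1 true  = s≤s z≤n
bit≤1 false = z≤n

module Machine {n m} {Φ : Formula n m} (O : Oracle Φ) where
  open Run O
  open Search Φ

  Constants : ℕ → State → Set
  Constants now σ = reg σ rsize ≡ n × 0 < reg σ rrun × reg σ rzero ≡ 0 × reg σ rone ≡ 1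
    × reg σ rtwice ≡ n + n × reg σ rnow ≡ now

  Stored : ℕ → (ℕ → Bool) → (ℕ → ℕ) → State → Set
  Stored k x c σ = (∀ i → i < k → arr σ bits i ≡ bit (x i))
    × (∀ i → i < k → arr σ ranks i ≡ rank (x i) i)
    × (∀ i → i < k → arr σ changed i ≡ c i)

  Stamps : (ℕ → ℕ) → State → Set
  Stamps S σ = ∀ i → arr σ stamp i ≡ S i

  -- Five steps for each of the `f` positions left, and one to leave the loop.
  clear : ∀ {x c now S P h T} f {k} σ → Constants now σ → Stored k x c σ → Stamps S σ →
    reg σ rk ≡ k → f + k ≡ n → (∀ i → k ≤ i → x i ≡ false × c i ≡ now) →
    (∀ σ′ → Constants now σ′ → Stored n x c σ′ → Stamps S σ′ → Decides ⟨ P , σ′ , h ⟩ T) →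
    Decides ⟨ while rk rsize clearBody ∷ P , σ , h ⟩ (f * 5 + suc T)
  clear zero σ con sto sta k≡ refl rest cont =
    while-false (≤-reflexive (trans (proj₁ con) (sym k≡))) (cont σ con sto sta)
  clear {x} {c} {now} (suc f) {k} σ con@(n≡ , _ , z≡ , o≡ , _ , t≡) (B , R , C) sta k≡ f+k rest cont =
    while-true (subst₂ _<_ (sym k≡) (sym n≡) (≤-trans (s≤s (m≤n+m k f)) (≤-reflexive f+k)))
      (tick refl (tick refl (tick refl (tick refl
        (clear f _ con
          ( extend-prefix k≡ (trans z≡ (cong bit (sym x≡))) B
          , extend-prefix k≡ (trans k≡ (cong (λ b → rank b k) (sym x≡))) R
          , extend-prefix k≡ (trans t≡ (sym c≡)) C)
          sta (trans (cong₂ _+_ k≡ o≡) (+-comm k 1)) (trans (+-suc f k) f+k)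
          (λ i k<i → rest i (<⇒≤ k<i)) cont)))))
    where
    x≡ = proj₁ (rest k ≤-refl)
    c≡ = proj₂ (rest k ≤-refl)

  scan-none : ∀ {x c s k z} → (c k ≤ s → x k ≡ true) → Scanned x c s k z → Scanned x c s (suc k) z
  scan-none {x} {c} {s} {k} one (none all) = none extended
    where
    extended : ∀ {i} → i < suc k → c i ≤ s → x i ≡ true
    extended i<1+k with m≤n⇒m<n∨m≡n (s≤s⁻¹ i<1+k)
    ... | inj₁ i<k = all i<k
    ... | inj₂ refl = one
  scan-none {x} {c} {s} {k} one (last {q} q<k cq xq all) = last (m<n⇒m<1+n q<k) cq xq extended
    where
    extended : ∀ {i} → q < i → i < suc k → c i ≤ s → x i ≡ true
    extended q<i i<1+k with m≤n⇒m<n∨m≡n (s≤s⁻¹ i<1+k)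
    ... | inj₁ i<k = all q<i i<k
    ... | inj₂ refl = one

  scan-last : ∀ {x c s k} → c k ≤ s → x k ≡ false → Scanned x c s (suc k) (suc k)
  scan-last ck xk = last ≤-refl ck xk (λ k<i i<1+k → contradiction k<i (≤⇒≯ (s≤s⁻¹ i<1+k)))

  scan : ∀ {x c now S s P h T} f {k z} σ → Constants now σ → Stored n x c σ → Stamps S σ →
    reg σ rk ≡ k → reg σ rmark ≡ z → reg σ rstamp ≡ s → f + k ≡ n → Scanned x c s k z →
    (∀ {z′} σ′ → Constants now σ′ → Stored n x c σ′ → Stamps S σ′ → reg σ′ rmark ≡ z′ →
      Scanned x c s n z′ → Decides ⟨ P , σ′ , h ⟩ T) →
    Decides ⟨ while rk rsize scanBody ∷ P , σ , h ⟩ (f * 7 + suc T)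
  scan zero σ con sto sta k≡ z≡ s≡ refl sc cont =
    while-false (≤-reflexive (trans (proj₁ con) (sym k≡))) (cont σ con sto sta z≡ sc)
  scan {x} {c} {s = s} (suc f) {k} σ con@(n≡ , _ , _ , o≡ , _) sto@(B , _ , C) sta k≡ z≡ s≡ f+k sc cont =
    while-true (subst₂ _<_ (sym k≡) (sym n≡) k<n) (tick refl examine)
    where
    k<n : k < n
    k<n = ≤-trans (s≤s (m≤n+m k f)) (≤-reflexive f+k)
    k+1 = trans (cong₂ _+_ k≡ o≡) (+-comm k 1)
    f+k+1 = trans (+-suc f k) f+k
    ck≡ : arr σ changed (reg σ rk) ≡ c k
    ck≡ = trans (cong (arr σ changed) k≡) (C k k<n)
    xk≡ : arr σ bits (reg σ rk) ≡ bit (x k)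
    xk≡ = trans (cong (arr σ bits) k≡) (B k k<n)
    examine : Decides _ _
    examine with s <? c k
    -- This path takes four of the seven steps allowed per position.
    ... | yes s<c = ifless-true (subst₂ _<_ (sym s≡) (sym ck≡) s<c) (tick refl
      (relax (m≤n+m _ 3) (scan f _ con sto sta k+1 z≡ s≡ f+k+1
        (scan-none (λ c≤s → contradiction c≤s (<⇒≱ s<c)) sc) cont)))
    ... | no s≮c = ifless-false (subst₂ _≤_ (sym ck≡) (sym s≡) (≮⇒≥ s≮c)) (tick refl branch)
      where
      branch : Decides _ _
      branch with x k in xk
      ... | false = ifless-true (subst₂ _<_ (sym (trans xk≡ (cong bit xk))) (sym o≡) (s≤s z≤n)) (tick refl (tick refl
        (scan f _ con sto sta k+1 k+1 s≡ f+k+1 (scan-last (≮⇒≥ s≮c) xk) cont)))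
      ... | true = ifless-false (≤-reflexive (trans o≡ (sym (trans xk≡ (cong bit xk))))) (tick refl
        (relax (m≤n+m _ 1) (scan f _ con sto sta k+1 z≡ s≡ f+k+1 (scan-none (λ _ → xk) sc) cont)))

  update-cong : ∀ {f g : ℕ → ℕ} {v w} a → v ≡ w → (∀ i → f i ≡ g i) → ∀ i → (f [ a ↦ v ]) i ≡ (g [ a ↦ w ]) i
  update-cong a v≡w f≡g i = cong₂ (if does (i ≟ a) then_else_) v≡w (f≡g i)

  numerator-bits : ∀ {x c σ} → Stored n x c σ → ∀ ℓ → numerator 1 (arr σ bits) ℓ ≡ bit (not (holds x ℓ))
  numerator-bits {x} (B , _) (pos i) = trans (cong (1 ∸_) (B _ (toℕ<n i))) (complement (x (toℕ i)))
    where
    complement : ∀ b → 1 ∸ bit b ≡ bit (not b)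
    complement true  = refl
    complement false = refl
  numerator-bits {x} (B , _) (neg i) = trans (B _ (toℕ<n i)) (cong bit (sym (not-involutive (x (toℕ i)))))

  numerator-ranks : ∀ {x c σ} → Stored n x c σ → ∀ ℓ → numerator (n + n) (arr σ ranks) ℓ ≡ weight x ℓ
  numerator-ranks {x} (_ , R , _) (pos i) = trans (cong (n + n ∸_) (R _ (toℕ<n i))) (complement (x (toℕ i)))
    where
    complement : ∀ b → n + n ∸ rank b (toℕ i) ≡ rank (not b) (toℕ i)
    complement true  = m∸[m∸n]≡n (≤-trans (<⇒≤ (toℕ<n i)) (m≤m+n n n))
    complement false = refl
  numerator-ranks {x} (_ , R , _) (neg i) =
    trans (R _ (toℕ<n i)) (cong (λ b → rank b (toℕ i)) (sym (not-involutive (x (toℕ i)))))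

  rank-≤ : ∀ b (i : Fin n) → rank b (toℕ i) ≤ n + n
  rank-≤ true  i = m∸n≤m (n + n) (toℕ i)
  rank-≤ false i = ≤-trans (<⇒≤ (toℕ<n i)) (m≤m+n n n)

  bit-zero : ∀ {b} → bit (not b) ≡ 0 → b ≡ true
  bit-zero {true} _ = refl

  -- Per bit, 5 steps to clear and 7 to scan; 20 for the rest of the longest path through a round.
  roundTime : ℕ
  roundTime = 20 + n * 12

  loop : Program
  loop = while rzero rrun search ∷ []

  -- What holds at the head of the main loop; clearing the positions from z on is left to its body.
  record Ready (z : ℕ) (σ : State) (e : Vector ℕ m) : Set where
    field
      {x}       : ℕ → Bool
      {c S}     : ℕ → ℕ
      {now}     : ℕ
      constants : Constants now σ
      stored    : Stored z x c σ
      stamps    : Stamps S σ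
      mark      : reg σ rmark ≡ z
      z≤size    : z ≤ n
      rest      : ∀ i → z ≤ i → x i ≡ false × c i ≡ now
      invariant : Invariant x c now S e

  -- Stands for the remaining rounds, so that one round is verified by itself and the induction on
  -- the potential is left to `rounds`.
  Continues : Vector ℕ m → ℕ → Set
  Continues e R = ∀ {z⁺ σ⁺ e⁺ h⁺} → Ready z⁺ σ⁺ e⁺ → total e⁺ < total e → Decides ⟨ loop , σ⁺ , h⁺ ⟩ R

  module _ {x c now S e j R} (inv : Invariant x c now S e) (¬x : ¬ Models x) (worst : Worst x j)
    (continue : Continues e R) where

    move-on : ∀ {S⁺ s z h} σ → Constants now σ → Stored n x c σ → Stamps S⁺ σ → reg σ rmark ≡ z →
      Scanned x c s n z → Blocked inv ¬x worst s → (∀ {i} → i ≢ suc (toℕ j) → S⁺ i ≡ S i) →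
      (∀ {q} → q < n → x q ≡ false → c q ≤ s →
        ∃[ e′ ] (Log (increment q x) (stampFrom q (suc now) c) (suc now) j (S⁺ (suc (toℕ j))) e′ × e′ < e j)) →
      Decides ⟨ ifless rzero rmark advance (const 0 0 ∷ const rrun 0 ∷ []) ∷ loop , σ , h ⟩ (7 + R)
    -- Every assignment agrees with `x` on the empty prefix, so a mark of 0 excludes all models.
    move-on {z = zero} σ con sto sta z≡ sc blocked S⁺≡ relogged =
      ifless-false (≤-trans (≤-reflexive z≡) z≤n) (tick refl (tick refl (while-false z≤n
        (halted (inj₂ (refl , unsatisfiable λ x′ models →
          scanned-stuck inv ¬x worst blocked sc {x′} models λ _ ()))))))
    move-on {z = suc q} σ con@(_ , _ , z≡0 , o≡ , d≡ , t≡) (B , K , C) sta z≡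
      sc@(last q<n cq xq _) blocked S⁺≡ relogged
      with proceed inv ¬x worst q<n xq S⁺≡ (relogged q<n xq cq) (scanned-stuck inv ¬x worst blocked sc)
    ... | e⁺ , inv⁺ , smaller =
      ifless-true (subst₂ _<_ (sym z≡0) (sym z≡) (s≤s z≤n))
        (tick refl (tick refl (tick refl (tick refl (tick refl (tick refl (continue ready smaller)))))))
      where
      k≡ : reg σ rmark ∸ reg σ rone ≡ q
      k≡ = cong₂ _∸_ z≡ o≡
      now≡ : reg σ rnow + reg σ rone ≡ suc now
      now≡ = trans (cong₂ _+_ t≡ o≡) (+-comm now 1)
      -- `advance` writes only position `q` of the assignment and leaves `rmark` at `q + 1`, where
      -- the next round starts clearing.
      ready : Ready (suc q) _ e⁺
      ready = record
        { constants = proj₁ con , proj₁ (proj₂ con) , z≡0 , o≡ , d≡ , now≡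
        ; stored =
            extend-prefix k≡ (trans o≡ (cong bit (sym (increment-at {q} {x}))))
              (λ i i<q → trans (B i (<-trans i<q q<n)) (cong bit (sym (increment-below {x = x} i<q))))
          , extend-prefix k≡ (trans (cong₂ _∸_ d≡ k≡) (cong (λ b → rank b q) (sym (increment-at {q} {x}))))
              (λ i i<q → trans (K i (<-trans i<q q<n)) (cong (λ b → rank b i) (sym (increment-below {x = x} i<q))))
          , extend-prefix k≡ (trans now≡ (sym (stampFrom-above {c = c} ≤-refl)))
              (λ i i<q → trans (C i (<-trans i<q q<n)) (sym (stampFrom-below {c = c} i<q)))
        ; stamps = sta
        ; mark = z≡
        ; z≤size = q<n
        ; rest = λ i q<i → increment-above {x = x} q<i , stampFrom-above {c = c} (<⇒≤ q<i)
        ; invariant = inv⁺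
        }

    scanning : Program
    scanning = const rmark 0 ∷ const rk 0 ∷ while rk rsize scanBody ∷
      ifless rzero rmark advance (const 0 0 ∷ const rrun 0 ∷ []) ∷ loop

    examine : ∀ {h} σ → Constants now σ → Stored n x c σ → Stamps S σ → reg σ rreply ≡ suc (toℕ j) →
      reg σ rstamp ≡ S (suc (toℕ j)) →
      Decides ⟨ ifless rstamp rone remember [] ∷ scanning , σ , h ⟩ (5 + (n * 7 + (8 + R)))
    examine σ con@(_ , _ , _ , o≡ , _ , t≡) sto sta r≡ s≡ with S (suc (toℕ j)) in Sj
    ... | zero = ifless-true (subst₂ _<_ (sym s≡) (sym o≡) (s≤s z≤n)) (tick refl (tick refl (tick refl (tick refl
      (scan n _ con sto updated refl refl t≡ (+-identityʳ n) (none λ ()) λ σ′ con′ sto′ sta′ z≡ sc →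
        move-on σ′ con′ sto′ sta′ z≡ sc (blocked-fresh inv ¬x worst) (updated-other S now) λ q<n xq _ →
          _ , subst (λ s → Log _ _ _ j s _) (sym (updated-same S (suc (toℕ j)) now))
                (proj₁ (log-fresh inv ¬x worst q<n xq (logged inv j) Sj))
            , proj₂ (log-fresh inv ¬x worst q<n xq (logged inv j) Sj))))))
      where
      updated : ∀ i → (arr σ stamp [ reg σ rreply ↦ reg σ rnow ]) i ≡ (S [ suc (toℕ j) ↦ now ]) i
      updated i = trans (cong (λ a → (arr σ stamp [ a ↦ reg σ rnow ]) i) r≡) (update-cong _ t≡ sta i)
    ... | suc s = ifless-false (subst₂ _≤_ (sym o≡) (sym s≡) (s≤s z≤n)) (relax (m≤n+m _ 2) (tick refl (tick refl
      (scan n _ con sto sta refl refl s≡ (+-identityʳ n) (none λ ()) λ σ′ con′ sto′ sta′ z≡ sc →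
        move-on σ′ con′ sto′ sta′ z≡ sc (blocked-seen inv ¬x worst (s≤s z≤n) logged-j) (λ _ → refl) λ q<n xq cq →
          let e′ , _ , log , smaller = relog inv ¬x worst q<n xq (logged inv j)
              0<S = subst (0 <_) (sym Sj) (s≤s z≤n)
          in e′ , log , smaller 0<S (subst (c _ ≤_) (sym Sj) cq)))))
      where
      logged-j : Log x c now j (suc s) (e j)
      logged-j = subst (λ s → Log x c now j s (e j)) Sj (logged inv j)

  module _ {e : Vector ℕ m} {R : ℕ} (continue : Continues e R) where

    leaf-decides : ∀ {x c now S h} σ → Constants now σ → Stored n x c σ → Stamps S σ →
      Invariant x c now S e → ¬ Models x → Fin m →
      Decides ⟨ leaf ++ loop , σ , h ⟩ (7 + (n * 7 + (8 + R)))
    leaf-decides {x} σ con@(_ , _ , _ , _ , d≡ , _) sto@(_ , K , _) sta inv ¬x j₀ =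
      ask twice (λ i → subst₂ _≤_ (sym (K _ (toℕ<n i))) D≡ (rank-≤ (x (toℕ i)) i)) answered
      where
      D≡ : n + n ≡ suc (pred (n + n))
      -- The variable of some clause witnesses that `n` is positive, so the denominator `2n` is not
      -- zero.
      D≡ = sym (suc-pred (n + n) {{>-nonZero (≤-trans (≤-<-trans z≤n (toℕ<n (var (Φ j₀)))) (m≤m+n n n))}})
      twice = trans d≡ D≡
      num≡ : ∀ k → numerator (suc (pred (n + n))) (arr σ ranks) (Φ k) ≡ weight x (Φ k)
      num≡ k = trans (cong (λ D → numerator D (arr σ ranks) (Φ k)) (sym D≡)) (numerator-ranks {σ = σ} sto (Φ k))
      answered : ∀ ρ h′ → Answer Φ (suc (pred (n + n))) (arr σ ranks) ρ →
        Decides ⟨ _ , setReg rreply (code ρ) σ , h′ ⟩ _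
      -- Weight 0 is below `n`, so a graded query without violations would make `x` a model.
      answered .satisfied h′ (satisfied zeros) = contradiction
        (λ k → weight-< {x} {Φ k} (subst (_< n) (sym (trans (sym (num≡ k)) (zeros k)))
          (≤-<-trans z≤n (toℕ<n (var (Φ j₀))))))
        ¬x
      answered (violated j) h′ (violated _ worst) = tick refl
        (examine inv ¬x (λ k → subst₂ _≤_ (num≡ k) (num≡ j) (worst k)) continue _ con sto sta refl (sta _))

    round : ∀ {z σ h} → Ready z σ e → Decides ⟨ loop , σ , h ⟩ (roundTime + R)
    round {z} {σ} ready = relax budget (while-true
      (subst (_< reg σ rrun) (sym (proj₁ (proj₂ (proj₂ constants)))) (proj₁ (proj₂ constants)))
      (tick refl (clear (n ∸ z) _ constants stored stamps mark (m∸n+n≡m z≤size) rest λ σ′ con sto sta →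
        ask (proj₁ (proj₂ (proj₂ (proj₂ con)))) (λ i → subst (_≤ 1) (sym (proj₁ sto _ (toℕ<n i))) (bit≤1 _))
          (answered σ′ con sto sta))))
      where
      open Ready ready
      answered : ∀ σ′ → Constants now σ′ → Stored n x c σ′ → Stamps S σ′ →
        ∀ ρ h′ → Answer Φ 1 (arr σ′ bits) ρ → Decides ⟨ _ , setReg rreply (code ρ) σ′ , h′ ⟩ (8 + (n * 7 + (8 + R)))
      answered σ′ con sto sta .satisfied h′ (satisfied zeros) =
        ifless-false z≤n (tick refl (tick refl (while-false z≤n (halted (inj₁ (refl , x ∘ toℕ
          , λ j → bit-zero (trans (sym (numerator-bits {σ = σ′} sto (Φ j))) (zeros j))))))))
      answered σ′ con sto sta (violated j) h′ (violated some _) =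
        ifless-true (subst (_< suc (toℕ j)) (sym (proj₁ (proj₂ (proj₂ con)))) (s≤s z≤n))
          (leaf-decides _ con sto sta invariant
            (λ models → some λ k → trans (numerator-bits {σ = σ′} sto (Φ k)) (cong (bit ∘ not) (models k))) j)
      arithmetic : ∀ a R → 2 + (a * 5 + (10 + (a * 7 + (8 + R)))) ≡ 20 + a * 12 + R
      arithmetic = solve-∀
      budget : 2 + ((n ∸ z) * 5 + (10 + (n * 7 + (8 + R)))) ≤ roundTime + R
      budget = ≤-trans (+-monoʳ-≤ 2 (+-monoˡ-≤ _ (*-monoˡ-≤ 5 (m∸n≤m n z)))) (≤-reflexive (arithmetic n R))

  rounds : ∀ fuel {z σ e h} → Ready z σ e → total e ≤ fuel → Decides ⟨ loop , σ , h ⟩ (suc fuel * roundTime)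
  -- At potential 0 no further round can follow, so this one needs no time for a continuation.
  rounds zero ready le = round {R = 0} (λ _ lt → contradiction (≤-trans lt le) λ ()) ready
  rounds (suc fuel) ready le = round (λ ready⁺ lt → rounds fuel ready⁺ (s≤s⁻¹ (≤-trans lt le))) ready

  start : 0 < m → Decides (initial n m solver) (5 + suc (m * n) * roundTime)
  start 0<m = ifless-true 0<m (tick refl (tick refl (tick refl (relax (m≤n+m _ 1)
    (rounds (m * n) ready (≤-reflexive (total-const m n)))))))
    where
    ready : Ready 0 _ (λ _ → n)
    ready = record
      -- Time starts at 1, as stamp 0 means unseen.
      { x = λ _ → false ; c = λ _ → 1 ; S = λ _ → 0
      ; constants = refl , 0<m , refl , refl , refl , refl
      ; stored = (λ _ ()) , (λ _ ()) , (λ _ ())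
      ; stamps = λ _ → refl
      ; mark = refl
      ; z≤size = z≤n
      ; rest = λ _ _ → refl , refl
      ; invariant = record
        { minimal = λ { _ (_ , _ , _ , _ , ()) }
        ; past = λ _ → ≤-refl
        ; started = s≤s z≤n
        ; logged = λ _ → fresh
        }
      }

theorem2 : Σ[ P ∈ Program ] Σ[ C ∈ ℕ ]
    (∀ (n m : ℕ) (Φ : Formula n m) (O : Oracle Φ) →
    ∃[ t ] ∃[ σ ]
    (O ⊢ initial n m P ⇓[ t ] σ
    × t ≤ C * suc (m * n ^ 2)
    × CorrectVerdict Φ σ))
theorem2 = solver , 64 , solves
  where
  solves : ∀ n m (Φ : Formula n m) (O : Oracle Φ) →
    ∃[ t ] ∃[ σ ] (O ⊢ initial n m solver ⇓[ t ] σ × t ≤ 64 * suc (m * n ^ 2) × CorrectVerdict Φ σ)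
  -- Without clauses `m * n ^ 2` is 0, and the `suc` in the bound pays for the two steps.
  solves n zero Φ O = _ , _ , next refl (next refl halt) , s≤s (s≤s z≤n)
    , inj₁ (refl , (λ _ → false) , λ ())
  solves zero (suc m) Φ O with Φ Fin.zero
  ... | pos ()
  ... | neg ()
  solves (suc n) (suc m) Φ O = _ , _ , run , ≤-trans time≤ bound , correct
    where
    open Run.Decides (Machine.start O (s≤s z≤n))
    -- With at least one clause and one variable, the lower-order terms are absorbed by `m * n ^ 2`.
    -- The constant 64 is large enough for the difference to have only positive coefficients.
    slack : ∀ n m → 64 * suc (suc m * (suc n * (suc n * 1)))
      ≡ 5 + suc (suc m * suc n) * (20 + suc n * 12)
        + (59 + 72 * n + 52 * n * n + 32 * m + 84 * m * n + 52 * m * n * n)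
    slack = solve-∀
    bound : 5 + suc (suc m * suc n) * (20 + suc n * 12) ≤ 64 * suc (suc m * suc n ^ 2)
    bound = ≤-trans (m≤m+n _ _) (≤-reflexive (sym (slack n m)))
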